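{- For every positive integer $n$, the Catalan matroid $\mathbf{C}_n$ is self-dual, i.e. $\mathbf{C}_n \cong \mathbf{C}_n^{*}$, where $\mathbf{C}_n^{*}$ denotes the dual matroid.
   Context: A Dyck path of length $2n$ is a path in the plane from $(0,0)$ to $(2n,0)$, with steps $(1,1)$ (up-steps) and $(1,-1)$ (down-steps), that never passes below the $x$-axis. Its up-step set is the set of $i\in[2n]=\{1,\dots,2n\}$ for which the $i$-th step is an up-step. The Catalan matroid $\mathbf{C}_n$ is the matroid on the ground set $[2n]$ whose bases are the up-step sets of all Dyck paths of length $2n$. A matroid $M$ is called self-dual if $M$ is isomorphic to its dual $M^*$ (equality $M=M^*$ is not required). -}

module Defs where

open import Data.Fin using (Fin; zero; suc; _≟_)
open import Data.Fin.Permutation using (Permutation; _⟨$⟩ˡ_)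
open import Data.Fin.Properties using (any?)
open import Data.Fin.Subset
  using (Subset; inside; outside; _∈_; _∉_; _⊆_; _⊂_; _∪_; _─_; _-_; ∁; ⁅_⁆)
open import Data.Fin.Subset.Induction using (⊂-wellFounded)
open import Data.Fin.Subset.Properties
  using ( _∈?_; ⊆-antisym; p─⊥≡p; ∪-identityʳ; p─q⊆p; x∈p∧x≢y⇒x∈p-y
        ; x∈⁅x⁆; x∈⁅y⁆⇒x≡y; x∈p∪q⁻; x∈p∪q⁺; x∈p∧x∉q⇒x∈p─q
        ; x∈p⇒x∉∁p; x∈∁p⇒x∉p; x∉∁p⇒x∈p; x∉p⇒x∈∁p)
open import Data.Nat using (ℕ; zero; suc; _+_; _*_; _≤_; s≤s)
open import Data.Nat.Properties using (≤-refl; m≤n⇒m≤1+n; 1+n≰n; ≤-trans; n≤1+n; +-suc; +-identityʳ)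
open import Data.Product using (∃; _×_; _,_)
open import Data.Sum using (_⊎_; inj₁; inj₂)
open import Data.Vec using ([]; _∷_; here; there; lookup; tabulate)
open import Function using (_∘_; _⇔_)
open import Induction.WellFounded using (Acc; acc)
open import Level using (0ℓ)
open import Relation.Binary.PropositionalEquality
  using (_≡_; _≢_; refl; sym; trans; cong; subst)
open import Relation.Nullary using (¬_; yes; no; contradiction; _×-dec_; ¬?; decidable-stable)
open import Relation.Unary using (Pred)

record Matroid (n : ℕ) : Set₁ where
  field
    IsBasis  : Pred (Subset n) 0ℓ
    nonempty : ∃ IsBasis
    exchange : ∀ {A B x} → IsBasis A → IsBasis B → x ∈ A → x ∉ B →
               ∃ λ y → y ∈ B × y ∉ A × IsBasis ((A - x) ∪ ⁅ y ⁆)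

open Matroid public

private
  variable
    n : ℕ

  ─⁻ : ∀ {n} (p q : Subset n) {x} → x ∈ p ─ q → x ∉ q
  ─⁻ (s ∷ p) (inside ∷ q) ()         here
  ─⁻ (s ∷ p) (t      ∷ q) (there x∈) (there x∈q) = ─⁻ p q x∈ x∈q

  ∈-swap⁻ : ∀ {A : Subset n} {x y z} → z ∈ (A - x) ∪ ⁅ y ⁆ → (z ∈ A × z ≢ x) ⊎ z ≡ y
  ∈-swap⁻ {A = A} {x} {y} {z} z∈ with x∈p∪q⁻ (A - x) ⁅ y ⁆ z∈
  ... | inj₁ z∈A-x = inj₁ (p─q⊆p A ⁅ x ⁆ z∈A-x , λ { refl → ─⁻ A ⁅ x ⁆ z∈A-x (x∈⁅x⁆ x) })
  ... | inj₂ z∈y   = inj₂ (x∈⁅y⁆⇒x≡y y z∈y)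

  ∈-swap⁺ : ∀ {A : Subset n} {x y z} → (z ∈ A × z ≢ x) ⊎ z ≡ y → z ∈ (A - x) ∪ ⁅ y ⁆
  ∈-swap⁺ (inj₁ (z∈A , z≢x)) = x∈p∪q⁺ (inj₁ (x∈p∧x≢y⇒x∈p-y z∈A z≢x))
  ∈-swap⁺ {y = y} (inj₂ refl) = x∈p∪q⁺ (inj₂ (x∈⁅x⁆ y))

  swap-⊂ : ∀ {A B : Subset n} {z w} → z ∈ B → z ∉ A → w ∈ A → w ∉ B →
           ((B - z) ∪ ⁅ w ⁆) ─ A ⊂ B ─ A
  swap-⊂ {A = A} {B} {z} {w} z∈B z∉A w∈A w∉B =
    B′─A⊆B─A , z , x∈p∧x∉q⇒x∈p─q z∈B z∉A , z∉B′─A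
    where
    B′ = (B - z) ∪ ⁅ w ⁆
    B′─A⊆B─A : B′ ─ A ⊆ B ─ A
    B′─A⊆B─A v∈ with ∈-swap⁻ (p─q⊆p B′ A v∈)
    ... | inj₁ (v∈B , _) = x∈p∧x∉q⇒x∈p─q v∈B (─⁻ B′ A v∈)
    ... | inj₂ refl      = contradiction w∈A (─⁻ B′ A v∈)
    z∉B′─A : z ∉ B′ ─ A
    z∉B′─A z∈ with ∈-swap⁻ (p─q⊆p B′ A z∈)
    ... | inj₁ (_ , z≢z) = z≢z refl
    ... | inj₂ refl      = w∉B z∈B

  module _ (M : Matroid n) where

    incomparable : ∀ {A B} → IsBasis M A → IsBasis M B → A ⊆ B → B ⊆ A
    incomparable {A} bA bB A⊆B {x} x∈B with x ∈? A
    ... | yes x∈A = x∈A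
    ... | no  x∉A with exchange M bB bA x∈B x∉A
    ...   | y , y∈A , y∉B , _ = contradiction (A⊆B y∈A) y∉B

    -- In `exchange` the element to be removed is given; here it is the element
    -- to be added.
    coexchange : ∀ {A B x} → Acc _⊂_ (B ─ A) → IsBasis M A → IsBasis M B →
                 x ∈ B → x ∉ A →
                 ∃ λ y → y ∈ A × y ∉ B × IsBasis M ((A - y) ∪ ⁅ x ⁆)
    coexchange {A} {B} {x} (acc rec) bA bB x∈B x∉A
      with any? (λ z → (z ∈? B) ×-dec (¬? (z ∈? A)) ×-dec (¬? (z ≟ x)))
    ... | yes (z , z∈B , z∉A , z≢x)
      with w , w∈A , w∉B , bB′ ← exchange M bB bA z∈B z∉A
      with y , y∈A , y∉B′ , bA′ ← coexchange (rec (swap-⊂ z∈B z∉A w∈A w∉B)) bA bB′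
                                    (∈-swap⁺ (inj₁ (x∈B , z≢x ∘ sym))) x∉A
      = y , y∈A , (λ y∈B → y∉B′ (∈-swap⁺ (inj₁ (y∈B , λ { refl → z∉A y∈A })))) , bA′
    coexchange {A} {B} {x} _ bA bB x∈B x∉A | no ∄z
      with y , y∈A , y∉B , bB′ ← exchange M bB bA x∈B x∉A
      = y , y∈A , y∉B , subst (IsBasis M) (⊆-antisym B⊆ ⊆B) bB
      where
      onlyx : ∀ {z} → z ∈ B → z ≢ x → z ∈ A
      onlyx {z} z∈B z≢x = decidable-stable (z ∈? A) λ z∉A → ∄z (z , z∈B , z∉A , z≢x)
      B′⊆A : (B - x) ∪ ⁅ y ⁆ ⊆ A
      B′⊆A v∈ with ∈-swap⁻ v∈
      ... | inj₁ (v∈B , v≢x) = onlyx v∈B v≢x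
      ... | inj₂ refl        = y∈A
      B⊆ : B ⊆ (A - y) ∪ ⁅ x ⁆
      B⊆ {v} v∈B with v ≟ x
      ... | yes v≡x = ∈-swap⁺ (inj₂ v≡x)
      ... | no  v≢x = ∈-swap⁺ (inj₁ (onlyx v∈B v≢x , λ { refl → y∉B v∈B }))
      ⊆B : (A - y) ∪ ⁅ x ⁆ ⊆ B
      ⊆B v∈ with ∈-swap⁻ v∈
      ... | inj₂ refl = x∈B
      ... | inj₁ (v∈A , v≢y) with ∈-swap⁻ (incomparable bB′ bA B′⊆A v∈A)
      ...   | inj₁ (v∈B , _) = v∈B
      ...   | inj₂ v≡y       = contradiction v≡y v≢y

  ∁-involutive : (A : Subset n) → ∁ (∁ A) ≡ A
  ∁-involutive A = ⊆-antisym (x∉∁p⇒x∈p ∘ x∈∁p⇒x∉p) (x∉p⇒x∈∁p ∘ x∈p⇒x∉∁p)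

  ∁-swap : ∀ {A : Subset n} {x y} → x ∈ A → y ∉ A →
           (∁ A - y) ∪ ⁅ x ⁆ ≡ ∁ ((A - x) ∪ ⁅ y ⁆)
  ∁-swap {A = A} {x} {y} x∈A y∉A = ⊆-antisym to from
    where
    to : (∁ A - y) ∪ ⁅ x ⁆ ⊆ ∁ ((A - x) ∪ ⁅ y ⁆)
    to {v} v∈ = x∉p⇒x∈∁p λ v∈′ → clash (∈-swap⁻ v∈) (∈-swap⁻ v∈′)
      where
      clash : (v ∈ ∁ A × v ≢ y) ⊎ v ≡ x → ¬ ((v ∈ A × v ≢ x) ⊎ v ≡ y)
      clash (inj₁ (v∈∁A , _)) (inj₁ (v∈A , _)) = x∈∁p⇒x∉p v∈∁A v∈A
      clash (inj₁ (_ , v≢y))  (inj₂ v≡y)       = v≢y v≡y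
      clash (inj₂ v≡x)        (inj₁ (_ , v≢x)) = v≢x v≡x
      clash (inj₂ refl)       (inj₂ refl)      = y∉A x∈A
    from : ∁ ((A - x) ∪ ⁅ y ⁆) ⊆ (∁ A - y) ∪ ⁅ x ⁆
    from {v} v∈ with v ≟ x
    ... | yes v≡x = ∈-swap⁺ (inj₂ v≡x)
    ... | no  v≢x = ∈-swap⁺ (inj₁
          ( x∉p⇒x∈∁p (λ v∈A → x∈∁p⇒x∉p v∈ (∈-swap⁺ (inj₁ (v∈A , v≢x))))
          , λ v≡y → x∈∁p⇒x∉p v∈ (∈-swap⁺ (inj₂ v≡y))))

infix 9 _*ᴹ

_*ᴹ : Matroid n → Matroid n
IsBasis  (M *ᴹ) B = IsBasis M (∁ B)
nonempty (M *ᴹ) with A , bA ← nonempty M =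
  ∁ A , subst (IsBasis M) (sym (∁-involutive A)) bA
exchange (M *ᴹ) {A} {B} bA bB x∈A x∉B
  with y , y∈∁A , y∉∁B , b ← coexchange M (⊂-wellFounded _) bA bB
                               (x∉p⇒x∈∁p x∉B) (x∈p⇒x∉∁p x∈A)
  = y , x∉∁p⇒x∈p y∉∁B , x∈∁p⇒x∉p y∈∁A
  , subst (IsBasis M) (∁-swap x∈A (x∈∁p⇒x∉p y∈∁A)) b

-- The direct image π[A]: j ∈ π[A] iff π⁻¹ j ∈ A.
image : ∀ {m n} → Permutation m n → Subset m → Subset n
image π A = tabulate λ j → lookup A (π ⟨$⟩ˡ j)

infix 4 _≅_

_≅_ : ∀ {m n} → Matroid m → Matroid n → Set
_≅_ {m} {n} M N =
  ∃ λ (π : Permutation m n) → ∀ A → IsBasis M A ⇔ IsBasis N (image π A)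

SelfDual : Matroid n → Set
SelfDual M = M ≅ M *ᴹ

-- Path h k m consists of the lattice paths with m steps, each (1,1) or (1,-1),
-- from height h to height k. Since heights are natural numbers, such a path
-- never passes below the x-axis.
data Path : ℕ → ℕ → ℕ → Set where
  stop : ∀ {h} → Path h h 0
  up   : ∀ {h k m} → Path (suc h) k m → Path h k (suc m)
  down : ∀ {h k m} → Path h k m → Path (suc h) k (suc m)

DyckPath : ℕ → Set
DyckPath n = Path 0 0 (2 * n)

-- Steps are numbered from 0.
upSteps : ∀ {h k m} → Path h k m → Subset m
upSteps stop     = []
upSteps (up p)   = inside ∷ upSteps p
upSteps (down p) = outside ∷ upSteps p

private
  variable
    i j k m : ℕ

  upsThenDowns : ∀ n → Path 0 0 (2 * n)
  upsThenDowns n = ups n 0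
    where
    downs : ∀ h → Path h 0 (h + 0)
    downs zero    = stop
    downs (suc h) = down (downs h)
    ups : ∀ a h → Path h 0 (a + ((h + a) + 0))
    ups zero    h = subst (λ t → Path h 0 (t + 0)) (sym (+-identityʳ h)) (downs h)
    ups (suc a) h =
      up (subst (λ t → Path (suc h) 0 (a + (t + 0))) (sym (+-suc h a)) (ups a (suc h)))

  deleteUp : (p : Path i k m) {x : Fin m} → x ∈ upSteps p →
             ∃ λ (r : Path (suc (suc i)) k m) → upSteps r ≡ upSteps p - x
  deleteUp (up p) here = down p , cong (outside ∷_) (sym (p─⊥≡p _))
  deleteUp (up p) (there x∈) with r , eq ← deleteUp p x∈ = up r , cong (inside ∷_) eq
  deleteUp (down p) (there x∈) with r , eq ← deleteUp p x∈ = down r , cong (outside ∷_) eq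

  insertUp : (p : Path (suc (suc i)) k m) (q : Path j k m) → j ≤ i →
             ∃ λ y → y ∈ upSteps q × y ∉ upSteps p ×
             ∃ λ (r : Path i k m) → upSteps r ≡ upSteps p ∪ ⁅ y ⁆
  insertUp stop stop j≤i = contradiction (≤-trans (n≤1+n _) j≤i) 1+n≰n
  insertUp (up p) (up q) j≤i with insertUp p q (s≤s j≤i)
  ... | y , y∈ , y∉ , r , eq =
    suc y , there y∈ , (λ { (there y∈p) → y∉ y∈p }) , up r , cong (inside ∷_) eq
  insertUp (up p) (down q) j≤i with insertUp p q (m≤n⇒m≤1+n (≤-trans (n≤1+n _) j≤i))
  ... | y , y∈ , y∉ , r , eq =
    suc y , there y∈ , (λ { (there y∈p) → y∉ y∈p }) , up r , cong (inside ∷_) eq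
  insertUp (down p) (up q) j≤i =
    zero , here , (λ ()) , up p , cong (inside ∷_) (sym (∪-identityʳ _))
  insertUp (down p) (down q) (s≤s j≤i) with insertUp p q j≤i
  ... | y , y∈ , y∉ , r , eq =
    suc y , there y∈ , (λ { (there y∈p) → y∉ y∈p }) , down r , cong (outside ∷_) eq

  -- The new up-step is the first one of q that is not an up-step of p.
  exchangeUp : (p : Path i k m) (q : Path j k m) → j ≤ i → {x : Fin m} →
               x ∈ upSteps p → x ∉ upSteps q →
               ∃ λ y → y ∈ upSteps q × y ∉ upSteps p ×
               ∃ λ (r : Path i k m) → upSteps r ≡ (upSteps p - x) ∪ ⁅ y ⁆
  exchangeUp (up p) (up q) j≤i here x∉ = contradiction here x∉
  exchangeUp (up p) (down q) (s≤s j≤i) here x∉ with insertUp p q j≤i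
  ... | y , y∈ , y∉ , r , eq =
    suc y , there y∈ , (λ { (there y∈p) → y∉ y∈p }) , down r
    , cong (outside ∷_) (trans eq (cong (_∪ ⁅ y ⁆) (sym (p─⊥≡p _))))
  exchangeUp (up p) (up q) j≤i (there x∈) x∉ with exchangeUp p q (s≤s j≤i) x∈ (x∉ ∘ there)
  ... | y , y∈ , y∉ , r , eq =
    suc y , there y∈ , (λ { (there y∈p) → y∉ y∈p }) , up r , cong (inside ∷_) eq
  exchangeUp (up p) (down q) j≤i (there x∈) x∉
    with exchangeUp p q (m≤n⇒m≤1+n (≤-trans (n≤1+n _) j≤i)) x∈ (x∉ ∘ there)
  ... | y , y∈ , y∉ , r , eq =
    suc y , there y∈ , (λ { (there y∈p) → y∉ y∈p }) , up r , cong (inside ∷_) eq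
  exchangeUp (down p) (up q) j≤i (there x∈) x∉ with deleteUp p x∈
  ... | r , eq =
    zero , here , (λ ()) , up r , cong (inside ∷_) (trans eq (sym (∪-identityʳ _)))
  exchangeUp (down p) (down q) (s≤s j≤i) (there x∈) x∉ with exchangeUp p q j≤i x∈ (x∉ ∘ there)
  ... | y , y∈ , y∉ , r , eq =
    suc y , there y∈ , (λ { (there y∈p) → y∉ y∈p }) , down r , cong (outside ∷_) eq

Catalan : ∀ n → Matroid (2 * n)
IsBasis  (Catalan n) A = ∃ λ (p : DyckPath n) → upSteps p ≡ A
nonempty (Catalan n) = _ , upsThenDowns n , refl
exchange (Catalan n) (p , refl) (q , refl) x∈p x∉q
  with exchangeUp p q ≤-refl x∈p x∉q
... | y , y∈q , y∉p , r , eq = y , y∈q , y∉p , r , eq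

{-# OPTIONS --safe #-}
-- Reading a Dyck path backwards exchanges up-steps and down-steps, so its
-- up-step set becomes the complement of the mirror image. Hence i ↦ 2n + 1 − i
-- carries the bases of the Catalan matroid to the bases of its dual.
module Submission where

open import Algebra.Lattice.Properties.BooleanAlgebra using (¬-involutive)
open import Data.Bool using (not)
open import Data.Fin using (zero; suc; fromℕ; inject₁; opposite)
import Data.Fin.Permutation as Permutation
open import Data.Fin.Subset using (Subset; inside; outside; ∁)
open import Data.Fin.Subset.Properties using (∪-∩-booleanAlgebra)
open import Data.Nat using (ℕ; suc; NonZero)
open import Data.Product using (_,_)
open import Data.Vec using (Vec; []; _∷_; _∷ʳ_; lookup; reverse; tabulate)
open import Data.Vec.Properties
  using (reverse-∷; reverse-involutive; map-reverse; tabulate∘lookup; tabulate-cong)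
open import Function using (mk⇔)
open import Level using (Level)
open import Relation.Binary.PropositionalEquality
  using (_≡_; refl; sym; trans; cong; module ≡-Reasoning)
open import Defs using (SelfDual; Catalan; Path; stop; up; down; upSteps; image)

open ≡-Reasoning

private
  variable
    a : Level
    A : Set a
    h k m n : ℕ

lookup-∷ʳ-fromℕ : ∀ (xs : Vec A n) x → lookup (xs ∷ʳ x) (fromℕ n) ≡ x
lookup-∷ʳ-fromℕ []       x = refl
lookup-∷ʳ-fromℕ (_ ∷ xs) x = lookup-∷ʳ-fromℕ xs x

lookup-∷ʳ-inject₁ : ∀ (xs : Vec A n) x i → lookup (xs ∷ʳ x) (inject₁ i) ≡ lookup xs i
lookup-∷ʳ-inject₁ (_ ∷ _)  x zero    = refl
lookup-∷ʳ-inject₁ (_ ∷ xs) x (suc i) = lookup-∷ʳ-inject₁ xs x i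

-- Reversing `x ∷ xs` moves `x` to the end, and `opposite` sends `zero` to `fromℕ` and `suc i` to
-- `inject₁ (opposite i)`, so the two cases are the two lookups in a `∷ʳ`.
lookup-reverse-opposite : ∀ (xs : Vec A n) i → lookup (reverse xs) (opposite i) ≡ lookup xs i
lookup-reverse-opposite (x ∷ xs) zero =
  trans (cong (λ ys → lookup ys (fromℕ _)) (reverse-∷ x xs)) (lookup-∷ʳ-fromℕ (reverse xs) x)
lookup-reverse-opposite (x ∷ xs) (suc i) = begin
  lookup (reverse (x ∷ xs)) (inject₁ (opposite i)) ≡⟨ cong (λ ys → lookup ys (inject₁ (opposite i))) (reverse-∷ x xs) ⟩
  lookup (reverse xs ∷ʳ x) (inject₁ (opposite i))  ≡⟨ lookup-∷ʳ-inject₁ (reverse xs) x (opposite i) ⟩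
  lookup (reverse xs) (opposite i)                 ≡⟨ lookup-reverse-opposite xs i ⟩
  lookup xs i                                      ∎

image-reverse : (S : Subset n) → image Permutation.reverse S ≡ reverse S
image-reverse S = begin
  -- `image` looks up along the inverse permutation, which here is again `opposite`.
  tabulate (λ i → lookup S (opposite i))                     ≡⟨ cong (λ T → tabulate λ i → lookup T (opposite i)) (reverse-involutive S) ⟨
  tabulate (λ i → lookup (reverse (reverse S)) (opposite i)) ≡⟨ tabulate-cong (lookup-reverse-opposite (reverse S)) ⟩
  tabulate (lookup (reverse S))                              ≡⟨ tabulate∘lookup (reverse S) ⟩
  reverse S                                                  ∎

∁-involutive : (S : Subset n) → ∁ (∁ S) ≡ S
∁-involutive {n} = ¬-involutive (∪-∩-booleanAlgebra n)

-- The constructors of `Path` prepend steps, whereas reversal turns the first step into the last.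
snocUp : Path h k m → Path h (suc k) (suc m)
snocUp stop     = up stop
snocUp (up p)   = up (snocUp p)
snocUp (down p) = down (snocUp p)

snocDown : Path h (suc k) m → Path h k (suc m)
snocDown stop     = down stop
snocDown (up p)   = up (snocDown p)
snocDown (down p) = down (snocDown p)

upSteps-snocUp : (p : Path h k m) → upSteps (snocUp p) ≡ upSteps p ∷ʳ inside
upSteps-snocUp stop     = refl
upSteps-snocUp (up p)   = cong (inside ∷_) (upSteps-snocUp p)
upSteps-snocUp (down p) = cong (outside ∷_) (upSteps-snocUp p)

upSteps-snocDown : (p : Path h (suc k) m) → upSteps (snocDown p) ≡ upSteps p ∷ʳ outside
upSteps-snocDown stop     = refl
upSteps-snocDown (up p)   = cong (inside ∷_) (upSteps-snocDown p)
upSteps-snocDown (down p) = cong (outside ∷_) (upSteps-snocDown p)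

-- The reversed path visits the same heights, so it stays above the axis. Both endpoints are
-- arbitrary because the tails met in the recursion need not start at height 0.
reversePath : Path h k m → Path k h m
reversePath stop     = stop
reversePath (up p)   = snocDown (reversePath p)
reversePath (down p) = snocUp (reversePath p)

upSteps-reversePath : (p : Path h k m) → upSteps (reversePath p) ≡ reverse (∁ (upSteps p))
upSteps-reversePath stop   = refl
upSteps-reversePath (up p) = begin
  upSteps (snocDown (reversePath p))      ≡⟨ upSteps-snocDown (reversePath p) ⟩
  upSteps (reversePath p) ∷ʳ outside      ≡⟨ cong (_∷ʳ outside) (upSteps-reversePath p) ⟩
  reverse (∁ (upSteps p)) ∷ʳ outside      ≡⟨ reverse-∷ outside (∁ (upSteps p)) ⟨
  -- By computation this is `reverse (∁ (inside ∷ upSteps p))`.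
  reverse (outside ∷ ∁ (upSteps p))       ∎
upSteps-reversePath (down p) = begin
  upSteps (snocUp (reversePath p))        ≡⟨ upSteps-snocUp (reversePath p) ⟩
  upSteps (reversePath p) ∷ʳ inside       ≡⟨ cong (_∷ʳ inside) (upSteps-reversePath p) ⟩
  reverse (∁ (upSteps p)) ∷ʳ inside       ≡⟨ reverse-∷ inside (∁ (upSteps p)) ⟨
  reverse (inside ∷ ∁ (upSteps p))        ∎

-- Brings the basis condition of the dual into the form of `upSteps-reversePath`; `∁` acts
-- entrywise, hence commutes with `reverse`.
∁-image-reverse : (S : Subset n) → ∁ (image Permutation.reverse S) ≡ reverse (∁ S)
∁-image-reverse S = trans (cong ∁ (image-reverse S)) (map-reverse not S)

-- Two commuting involutions compose to an involution.
reverse-∁-involutive : (S : Subset n) → reverse (∁ (reverse (∁ S))) ≡ S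
reverse-∁-involutive S = begin
  reverse (∁ (reverse (∁ S))) ≡⟨ cong reverse (map-reverse not (∁ S)) ⟩
  reverse (reverse (∁ (∁ S))) ≡⟨ reverse-involutive (∁ (∁ S)) ⟩
  ∁ (∁ S)                     ≡⟨ ∁-involutive S ⟩
  S                           ∎

proposition2p8 : (n : ℕ) .{{_ : NonZero n}} → SelfDual (Catalan n)
proposition2p8 n = Permutation.reverse , λ S → mk⇔
  (λ { (p , refl) → reversePath p
     , trans (upSteps-reversePath p) (sym (∁-image-reverse (upSteps p))) })
  -- Here `q` has up-step set `reverse (∁ S)`, so reversing `q` applies the same involution a second
  -- time and recovers `S`.
  (λ { (q , eq) → reversePath q , (begin
       upSteps (reversePath q)     ≡⟨ upSteps-reversePath q ⟩
       reverse (∁ (upSteps q))     ≡⟨ cong (λ T → reverse (∁ T)) (trans eq (∁-image-reverse S)) ⟩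
       reverse (∁ (reverse (∁ S))) ≡⟨ reverse-∁-involutive S ⟩
       S                           ∎) })
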